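{- Let $G$ be an infinite group and $\vec m=(m_1,\dots,m_k)\in\mathbb{Z}^k$, $k\in\mathbb{N}$. Then (i) a subset $A\subseteq G$ is a Ramsey $\vec m$-product subset if and only if every infinite subset $X\subseteq G$ contains a countably infinite subset $Y$ such that $y_1^{m_1}y_2^{m_2}\cdots y_k^{m_k}\in A$ for all pairwise distinct $y_1,\dots,y_k\in Y$; (ii) the family $\varphi_{\vec m}$ of all Ramsey $\vec m$-product subsets of $G$ is a filter on $G$.
   Context: A subset $A$ of a group $G$ is a Ramsey $\vec m$-product subset, for $\vec m=(m_1,\dots,m_k)\in\mathbb{Z}^k$, if every infinite subset $X\subseteq G$ contains pairwise distinct $x_1,\dots,x_k\in X$ such that $x_{\sigma(1)}^{m_1}x_{\sigma(2)}^{m_2}\cdots x_{\sigma(k)}^{m_k}\in A$ for every permutation $\sigma\in S_k$. -}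

module Defs where

open import Algebra.Bundles using (Group)
open import Data.Fin.Base using (Fin)
open import Data.Fin.Permutation using (Permutation′; _⟨$⟩ʳ_)
open import Data.Integer.Base using (ℤ; +_; -[1+_])
open import Data.Nat.Base as ℕ using (ℕ)
open import Data.Product.Base using (Σ; ∃-syntax; _×_; _,_; proj₁)
open import Data.Unit.Polymorphic using (tt)
open import Data.Vec.Functional using (Vector)
open import Function.Base using (id)
open import Function.Bundles using (Bijection)
open import Level using (Level; _⊔_; suc)
open import Relation.Binary.Bundles using (Setoid)
open import Relation.Binary.Definitions using (_Respects_)
import Relation.Binary.Construct.On as On
import Relation.Binary.PropositionalEquality.Properties as ≡
open import Relation.Binary.PropositionalEquality.Core using (_≢_)
open import Relation.Nullary.Negation.Core using (¬_)
open import Relation.Unary using (Pred; _∩_; _⊆_)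
open import Relation.Unary.Polymorphic using (∅; U)

module _ {c ℓ : Level} where

  Finite : Setoid c ℓ → Set (c ⊔ ℓ)
  Finite S = ∃[ n ] Bijection (≡.setoid (Fin n)) S

  Infinite : Setoid c ℓ → Set (c ⊔ ℓ)
  Infinite S = ¬ Finite S

  CountablyInfinite : Setoid c ℓ → Set (c ⊔ ℓ)
  CountablyInfinite S = Bijection (≡.setoid ℕ) S

module Subsets {c ℓ : Level} (S : Setoid c ℓ) where
  open Setoid S

  -- A subset is a predicate invariant under the setoid equality.  The
  -- level is that of _≈_, which accommodates singletons and ranges of sequences.
  record Subset : Set (c ⊔ suc ℓ) where
    field
      member   : Pred Carrier ℓ
      respects : member Respects _≈_

  open Subset public

  infix 4 _∈ₛ_ _⊆ₛ_
  infixr 7 _∩ₛ_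

  _∈ₛ_ : Carrier → Subset → Set ℓ
  x ∈ₛ A = member A x

  _⊆ₛ_ : Subset → Subset → Set (c ⊔ ℓ)
  A ⊆ₛ B = member A ⊆ member B

  ∅ₛ : Subset
  ∅ₛ = record { member = ∅ ; respects = λ _ → id }

  Uₛ : Subset
  Uₛ = record { member = U ; respects = λ _ _ → tt }

  _∩ₛ_ : Subset → Subset → Subset
  A ∩ₛ B = record
    { member   = member A ∩ member B
    ; respects = λ x≈y (x∈A , x∈B) → respects A x≈y x∈A , respects B x≈y x∈B
    }

  -- Elements are compared by the ambient equality only; the membership
  -- proofs are ignored, so cardinality counts elements, not proofs.
  ⟦_⟧ : Subset → Setoid (c ⊔ ℓ) ℓ
  ⟦ A ⟧ = On.setoid {B = Σ Carrier (member A)} S proj₁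

  record IsFilter {r} (φ : Pred Subset r) : Set (c ⊔ suc ℓ ⊔ r) where
    field
      whole    : φ Uₛ
      proper   : ¬ φ ∅ₛ
      ∩-closed : ∀ {A B} → φ A → φ B → φ (A ∩ₛ B)
      ⊆-closed : ∀ {A B} → A ⊆ₛ B → φ A → φ B

module Products {c ℓ : Level} (G : Group c ℓ) where
  open Group G
  open Subsets setoid
  open import Algebra.Definitions.RawMonoid rawMonoid
    using () renaming (_×_ to _×ᴹ_; sum to product)

  infixr 8 _^_

  _^_ : Carrier → ℤ → Carrier
  x ^ (+ n)    = n ×ᴹ x
  x ^ -[1+ n ] = (ℕ.suc n ×ᴹ x) ⁻¹

  PairwiseDistinct : ∀ {k} → Vector Carrier k → Set ℓ
  PairwiseDistinct x = ∀ i j → i ≢ j → x i ≉ x j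

  -- x₁^m₁ x₂^m₂ ⋯ xₖ^mₖ, in this order.
  powerProduct : ∀ {k} → Vector ℤ k → Vector Carrier k → Carrier
  powerProduct m x = product (λ i → x i ^ m i)

  Ramsey : ∀ {k} → Vector ℤ k → Pred Subset (c ⊔ suc ℓ)
  Ramsey {k} m A =
    ∀ (X : Subset) → Infinite ⟦ X ⟧ →
    ∃[ x ] (∀ i → x i ∈ₛ X) × PairwiseDistinct x ×
           (∀ (σ : Permutation′ k) → powerProduct m (λ i → x (σ ⟨$⟩ʳ i)) ∈ₛ A)

{-# OPTIONS --safe #-}
-- Excluded middle for arbitrary types is a choice operator: an infinite set X
-- contains an injective sequence s.  Colour the increasing k-tuples n of indices
-- by whether all rearrangements of (s n₁, …, s nₖ) have their power product in A,
-- and pass to a homogeneous subsequence by Ramsey's theorem.  Its range Y is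
-- infinite, so if A is Ramsey then Y contains a tuple of the good colour; hence
-- every increasing tuple is good, and every tuple of distinct elements of Y is a
-- rearrangement of an increasing one.  This gives (i), and the intersection
-- property in (ii) follows from (i) by passing to subsequences twice.
module Submission where

open import Defs
open import Algebra.Bundles using (Group)
import Algebra.Properties.Monoid.Mult as MonoidMult
import Algebra.Properties.Monoid.Sum as MonoidSum
open import Axiom.ExcludedMiddle using (ExcludedMiddle)
open import Data.Bool.Base using (Bool; true; false)
open import Data.Bool.Properties using (¬-not)
open import Data.Fin.Base as Fin using (Fin; toℕ)
open import Data.Fin.Permutation as Perm
  using (Permutation′; _⟨$⟩ʳ_; _⟨$⟩ˡ_; _∘ₚ_; lift₀; transpose)
open import Data.Fin.Properties using (toℕ-injective; ℕ→Fin-notInjective)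
import Data.Fin.Properties as Fin
open import Data.Integer.Base using (ℤ; -[1+_]) renaming (+_ to pos)
open import Data.List.Base using (allFin)
open import Data.List.Extrema.Nat using (argmin; f[argmin]≤f[xs])
open import Data.List.Membership.Propositional.Properties using (∈-allFin)
import Data.List.Relation.Unary.All as All
open import Data.Nat.Base using (ℕ; zero; suc; _+_; _≤_; _<_; z≤n; z<s; s<s; s<s⁻¹)
import Data.Nat.Properties as ℕ
open import Data.Product.Base using (∃-syntax; Σ-syntax; _×_; _,_; proj₁; proj₂; map₂)
open import Data.Sum.Base using (inj₁; inj₂)
open import Data.Unit.Polymorphic using (tt)
open import Data.Vec.Base as Vec using (Vec; []; _∷_)
open import Data.Vec.Functional using (Vector)
open import Data.Vec.Properties using (lookup-map; map-∘)
import Data.Vec.Relation.Unary.All as VecAll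
import Data.Vec.Relation.Unary.All.Properties as VecAll
open import Data.Vec.Relation.Unary.AllPairs as VecAllPairs using ([]; _∷_)
import Data.Vec.Relation.Unary.Unique.Setoid as VecUnique
open import Data.Vec.Relation.Unary.Unique.Setoid.Properties using (lookup-injective)
import Data.Vec.Relation.Unary.AllPairs.Properties as VecAllPairs
open import Function.Base using (id; _∘_)
open import Function.Properties.Inverse using (Inverse⇒Injection)
open import Function.Bundles using (_⇔_; mk⇔; Bijection; Injection; Surjection)
open import Function.Definitions using (Injective)
open import Level using (Level; _⊔_; Lift; lift; lower; 0ℓ)
open import Relation.Binary.Bundles using (Setoid)
open import Relation.Binary.Core using (_Preserves_⟶_)
open import Relation.Binary.Definitions using (tri<; tri≈; tri>)
open import Relation.Binary.PropositionalEquality.Core as ≡ using (_≡_; refl)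
open import Relation.Binary.PropositionalEquality.Properties using (module ≡-Reasoning)
import Relation.Binary.PropositionalEquality.Properties as ≡
open import Relation.Nullary.Decidable.Core
  using (yes; no; does; proof; map′; decidable-stable)
open import Relation.Nullary.Negation.Core using (contradiction)
open import Relation.Nullary.Reflects using (Reflects; ofʸ; invert; det)

private
  variable
    a ℓ : Level
    k n : ℕ

lower-em : ∀ p q → ExcludedMiddle (p ⊔ q) → ExcludedMiddle p
lower-em p q em {P} = map′ lower lift (em {Lift q P})

-- Strictly increasing maps and increasing tuples of indices.

StrictlyIncreasing : (ℕ → ℕ) → Set
StrictlyIncreasing f = f Preserves _<_ ⟶ _<_

Increasing : Vec ℕ n → Set
Increasing = VecAllPairs.AllPairs _<_

step-increasing : ∀ (f : ℕ → ℕ) → (∀ n → f n < f (suc n)) → StrictlyIncreasing f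
step-increasing f step {m} {suc n} m<1+n with ℕ.m<1+n⇒m<n∨m≡n m<1+n
... | inj₁ m<n  = ℕ.<-trans (step-increasing f step m<n) (step n)
... | inj₂ refl = step m

<⇒≉⇒injective : (S : Setoid a ℓ) → let open Setoid S in {f : ℕ → Carrier} →
                (∀ {m n} → m < n → f n ≉ f m) → Injective _≡_ _≈_ f
<⇒≉⇒injective S f-sep {m} {n} fm≈fn with ℕ.<-cmp m n
... | tri< m<n _ _ = contradiction (Setoid.sym S fm≈fn) (f-sep m<n)
... | tri≈ _ m≡n _ = m≡n
... | tri> _ _ m>n = contradiction fm≈fn (f-sep m>n)

strictlyIncreasing⇒injective : ∀ {f} → StrictlyIncreasing f → Injective _≡_ _≡_ f
strictlyIncreasing⇒injective f-inc = <⇒≉⇒injective (≡.setoid ℕ) (ℕ.>⇒≢ ∘ f-inc)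

map-increasing : ∀ {f} → StrictlyIncreasing f → {v : Vec ℕ n} →
                 Increasing v → Increasing (Vec.map f v)
map-increasing f-inc v-inc = VecAllPairs.map⁺ (VecAllPairs.map f-inc v-inc)

map-suc-increasing⁻ : (v : Vec ℕ n) → Increasing (Vec.map suc v) → Increasing v
map-suc-increasing⁻ []      []            = []
map-suc-increasing⁻ (_ ∷ v) (m<v ∷ v-inc) =
  VecAll.map s<s⁻¹ (VecAll.map⁻ m<v) ∷ map-suc-increasing⁻ v v-inc

positive⇒map-suc : (v : Vec ℕ n) → VecAll.All (0 <_) v → ∃[ w ] v ≡ Vec.map suc w
positive⇒map-suc []          VecAll.[]          = [] , refl
positive⇒map-suc (suc m ∷ v) (_ VecAll.∷ 0<v) with positive⇒map-suc v 0<v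
... | w , refl = m ∷ w , refl

-- Sorting tuples of distinct natural numbers.

minimum-first : (f : Vector ℕ (suc k)) → Σ[ τ ∈ Permutation′ (suc k) ]
                (∀ i → f (τ ⟨$⟩ʳ Fin.zero) ≤ f i)
minimum-first f = transpose Fin.zero (argmin f Fin.zero (allFin _)) ,
  λ i → All.lookup (f[argmin]≤f[xs] {f = f} Fin.zero (allFin _)) (∈-allFin i)

permute-injective : (τ : Permutation′ k) → Injective _≡_ _≡_ (τ ⟨$⟩ʳ_)
permute-injective τ = Inverse⇒Injection τ .Injection.injective

-- Selection sort: `ρ` brings a minimum to the front, injectivity makes every other entry strictly
-- larger, and the recursion sorts the tail by `τ`, which `lift₀` extends by fixing the front.
sort : (f : Vector ℕ k) → Injective _≡_ _≡_ f →
       ∃[ v ] Increasing v × Σ[ τ ∈ Permutation′ k ] (∀ i → Vec.lookup v i ≡ f (τ ⟨$⟩ʳ i))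
sort {zero}  f f-inj = [] , [] , Perm.id , λ ()
sort {suc k} f f-inj =
  let ρ , ρ-min = minimum-first f
      fρ-inj : Injective _≡_ _≡_ (f ∘ (ρ ⟨$⟩ʳ_))
      fρ-inj = permute-injective ρ ∘ f-inj
      v , v-inc , τ , v≗ = sort (f ∘ (ρ ⟨$⟩ʳ_) ∘ Fin.suc) (Fin.suc-injective ∘ fρ-inj)
      min<v : ∀ i → f (ρ ⟨$⟩ʳ Fin.zero) < Vec.lookup v i
      min<v i = ≡.subst (f (ρ ⟨$⟩ʳ Fin.zero) <_) (≡.sym (v≗ i))
        (ℕ.≤∧≢⇒< (ρ-min _) (Fin.0≢1+n ∘ fρ-inj))
  in f (ρ ⟨$⟩ʳ Fin.zero) ∷ v , VecAll.lookup⁻ min<v ∷ v-inc , lift₀ τ ∘ₚ ρ ,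
     λ where Fin.zero    → refl
             (Fin.suc i) → v≗ i

-- Ramsey's theorem for two colours.

module _ (em : ExcludedMiddle 0ℓ) where

  -- Either only `false` occurs from some `N` on, or `true` occurs beyond every bound; in the second
  -- case `p` jumps from each `true` to a later one.
  infinite-pigeonhole : (b : ℕ → Bool) → ∃[ p ] StrictlyIncreasing p × ∃[ t ] (∀ n → b (p n) ≡ t)
  infinite-pigeonhole b with em {∃[ N ] ∀ n → b (N + n) ≡ false}
  ... | yes (N , b≡false) = (N +_) , ℕ.+-monoʳ-< N , false , b≡false
  ... | no ¬eventually-false = p , step-increasing p p-step , true , b∘p
    where
    next : ∀ N → ∃[ n ] b (N + n) ≡ true
    next N = decidable-stable em λ ¬next →
      ¬eventually-false (N , λ n → ¬-not λ b≡true → ¬next (n , b≡true))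
    p : ℕ → ℕ
    p zero    = proj₁ (next 0)
    p (suc n) = suc (p n) + proj₁ (next (suc (p n)))
    p-step : ∀ n → p n < p (suc n)
    p-step n = ℕ.m≤m+n (suc (p n)) _
    b∘p : ∀ n → b (p n) ≡ true
    b∘p zero    = proj₂ (next 0)
    b∘p (suc n) = proj₂ (next (suc (p n)))

  Homogeneous : (Vec ℕ k → Bool) → (ℕ → ℕ) → Bool → Set
  Homogeneous c h t = ∀ v → Increasing v → c (Vec.map h v) ≡ t

  HasHomogeneous : (Vec ℕ k → Bool) → Set
  HasHomogeneous c = ∃[ h ] StrictlyIncreasing h × ∃[ t ] Homogeneous c h t

  -- Each step restricts the colouring to a subsequence along which, once the
  -- first index is fixed to be 0, the colour no longer depends on the others.
  module EndHomogeneous (ramsey : ∀ (c : Vec ℕ k → Bool) → HasHomogeneous c) where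

    module _ (c : Vec ℕ (suc k) → Bool) where
      private homogeneous = ramsey (c ∘ (0 ∷_) ∘ Vec.map suc)

      -- The colouring made homogeneous here has its first index fixed at `0`; `suc` keeps the other
      -- indices above it.
      step : ℕ → ℕ
      step = suc ∘ proj₁ homogeneous

      step-mono : StrictlyIncreasing step
      step-mono = s<s ∘ proj₁ (proj₂ homogeneous)

      colour : Bool
      colour = proj₁ (proj₂ (proj₂ homogeneous))

      step-homogeneous : ∀ v → Increasing v → c (0 ∷ Vec.map step v) ≡ colour
      step-homogeneous v v-inc = ≡.trans (≡.cong (c ∘ (0 ∷_)) (map-∘ suc _ v))
        (proj₂ (proj₂ (proj₂ homogeneous)) v v-inc)

      restrict : Vec ℕ (suc k) → Bool
      restrict = c ∘ Vec.map step

    -- The first `n` step maps of the successive restrictions, composed and applied to `0`.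
    -- Recursing on the colouring makes the tail of the sequence the image under `step c` of a
    -- sequence of the same kind.
    sequence : (Vec ℕ (suc k) → Bool) → ℕ → ℕ
    sequence c zero    = 0
    sequence c (suc n) = step c (sequence (restrict c) n)

    colours : (Vec ℕ (suc k) → Bool) → ℕ → Bool
    colours c zero    = colour c
    colours c (suc n) = colours (restrict c) n

    sequence-increasing : ∀ c → StrictlyIncreasing (sequence c)
    sequence-increasing c {zero}  {suc n} _   = z<s
    sequence-increasing c {suc m} {suc n} m<n =
      step-mono c (sequence-increasing (restrict c) (s<s⁻¹ m<n))

    map-sequence-suc : ∀ c (v : Vec ℕ n) → Vec.map (sequence c) (Vec.map suc v) ≡
                       Vec.map (step c) (Vec.map (sequence (restrict c)) v)
    map-sequence-suc c v = ≡.trans (≡.sym (map-∘ (sequence c) suc v))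
      (map-∘ (step c) (sequence (restrict c)) v)

    -- Induction on the first index. At `0` the other indices are positive, so they are sent into
    -- the image of `step c` and `step-homogeneous` applies. At `suc n` all indices are positive, so
    -- one `step c` is peeled off and `restrict c` replaces `c`.
    sequence-homogeneous : ∀ c n v → Increasing (n ∷ v) →
                           c (Vec.map (sequence c) (n ∷ v)) ≡ colours c n
    sequence-homogeneous c zero v (0<v ∷ v-inc) with positive⇒map-suc v 0<v
    ... | w , refl = ≡.trans (≡.cong (c ∘ (0 ∷_)) (map-sequence-suc c w))
      (step-homogeneous c _ (map-increasing (sequence-increasing (restrict c))
        (map-suc-increasing⁻ w v-inc)))
    sequence-homogeneous c (suc n) v (n<v ∷ v-inc)
      with positive⇒map-suc v (VecAll.map (ℕ.≤-<-trans z≤n) n<v)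
    ... | w , refl = ≡.trans (≡.cong c (map-sequence-suc c (n ∷ w)))
      (sequence-homogeneous (restrict c) n w (map-suc-increasing⁻ (n ∷ w) (n<v ∷ v-inc)))

  -- Induction on the tuple length. Along `sequence c` the colour depends only on the first index,
  -- and the pigeonhole principle thins the indices until it is constant.
  ramsey : ∀ k (c : Vec ℕ k → Bool) → HasHomogeneous c
  ramsey zero    c = id , id , c [] , λ where [] _ → refl
  ramsey (suc k) c with infinite-pigeonhole (EndHomogeneous.colours (ramsey k) c)
  ... | p , p-inc , t , const = sequence c ∘ p , sequence-increasing c ∘ p-inc , t , homogeneous
    where
    open EndHomogeneous (ramsey k)
    homogeneous : Homogeneous c (sequence c ∘ p) t
    homogeneous v@(n ∷ w) v-inc = begin
      c (Vec.map (sequence c ∘ p) v)             ≡⟨ ≡.cong c (map-∘ (sequence c) p v) ⟩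
      c (Vec.map (sequence c) (Vec.map p v))     ≡⟨ sequence-homogeneous c (p n) (Vec.map p w)
                                                      (map-increasing p-inc v-inc) ⟩
      colours c (p n)                            ≡⟨ const n ⟩
      t                                          ∎
      where open ≡-Reasoning

-- Infinite sets, injective sequences and their ranges.

countablyInfinite⇒infinite : {S : Setoid a ℓ} → CountablyInfinite S → Infinite S
countablyInfinite⇒infinite {S = S} ℕ⤖S (n , Fin⤖S) =
  ℕ→Fin-notInjective (to⁻ ∘ ℕ⤖S.to) λ {i} {j} eq →
    ℕ⤖S.injective (trans (sym (to∘to⁻ (ℕ⤖S.to i)))
      (trans (reflexive (≡.cong to eq)) (to∘to⁻ (ℕ⤖S.to j))))
  where
  open Setoid S
  open Bijection Fin⤖S
  open Surjection surjection using (to∘to⁻)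
  module ℕ⤖S = Bijection ℕ⤖S

module _ (S : Setoid a ℓ) (em : ExcludedMiddle (a ⊔ ℓ)) (S-infinite : Infinite S) where
  open Setoid S
  open VecUnique S using (Unique)

  -- If every element agreed with some entry of `xs`, then `Vec.lookup xs`, injective because the
  -- entries are distinct, would be a bijection from `Fin n`.
  fresh : (xs : Vec Carrier n) → Unique xs → ∃[ x ] VecAll.All (x ≉_) xs
  fresh {n} xs xs! with em {∃[ x ] ∀ i → x ≉ Vec.lookup xs i}
  ... | yes (x , x∉xs) = x , VecAll.lookup⁻ x∉xs
  ... | no ¬fresh = contradiction (n , Fin⤖S) S-infinite
    where
    surjective : ∀ y → ∃[ i ] (∀ {j} → j ≡ i → Vec.lookup xs j ≈ y)
    surjective y with Fin.any? (λ i → lower-em ℓ a em {y ≈ Vec.lookup xs i})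
    ... | yes (i , y≈xsᵢ) = i , λ where refl → sym y≈xsᵢ
    ... | no y∉xs = contradiction (y , λ i y≈xsᵢ → y∉xs (i , y≈xsᵢ)) ¬fresh
    Fin⤖S : Bijection (≡.setoid (Fin n)) S
    Fin⤖S = record
      { to        = Vec.lookup xs
      ; cong      = λ where refl → Setoid.refl S
      ; bijective = lookup-injective S xs! _ _ , surjective
      }

  distinct-prefix : ∀ n → Σ[ xs ∈ Vec Carrier n ] Unique xs
  distinct-prefix zero    = [] , []
  distinct-prefix (suc n) with distinct-prefix n
  ... | xs , xs! with fresh xs xs!
  ... | x , x∉xs = x ∷ xs , x∉xs ∷ xs!

  distinct-sequence : ℕ → Carrier
  distinct-sequence n = Vec.head (proj₁ (distinct-prefix (suc n)))

  -- Each prefix lists the terms of `distinct-sequence` so far, the latest at its head, so every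
  -- earlier term is met by descending through the tails.
  ∉prefix⇒≉sequence : ∀ {x m n} → m < n → VecAll.All (x ≉_) (proj₁ (distinct-prefix n)) →
                      x ≉ distinct-sequence m
  ∉prefix⇒≉sequence {n = suc n} m<1+n (x≉ VecAll.∷ x∉xs) with ℕ.m<1+n⇒m<n∨m≡n m<1+n
  ... | inj₁ m<n  = ∉prefix⇒≉sequence m<n x∉xs
  ... | inj₂ refl = x≉

  distinct-sequence-injective : Injective _≡_ _≈_ distinct-sequence
  distinct-sequence-injective = <⇒≉⇒injective S λ {_} {n} m<n →
    ∉prefix⇒≉sequence m<n (VecAllPairs.head (proj₂ (distinct-prefix (suc n))))

module _ {S : Setoid a ℓ} where
  open Setoid S
  open Subsets S

  range : (ℕ → Carrier) → Subset
  range f = record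
    { member   = λ x → ∃[ n ] x ≈ f n
    ; respects = λ x≈y (n , x≈fn) → n , trans (sym x≈y) x≈fn
    }

  range-countablyInfinite : ∀ {f} → Injective _≡_ _≈_ f → CountablyInfinite ⟦ range f ⟧
  range-countablyInfinite {f} f-inj = record
    { to        = λ n → f n , n , Setoid.refl S
    ; cong      = λ where refl → Setoid.refl S
    ; bijective = f-inj , λ (x , n , x≈fn) → n , λ where refl → sym x≈fn
    }

-- Power products and the equivalence of the two Ramsey conditions.

module _ {c ℓ} (G : Group c ℓ) where
  open Group G
  open Subsets setoid
  open Products G
  open MonoidMult monoid using (×-congʳ)
  open MonoidSum monoid using (sum-cong-≋)

  ^-congˡ : ∀ z {x y} → x ≈ y → x ^ z ≈ y ^ z
  ^-congˡ (pos n)  x≈y = ×-congʳ n x≈y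
  ^-congˡ -[1+ n ] x≈y = ⁻¹-cong (×-congʳ (suc n) x≈y)

  powerProduct-cong : (m : Vector ℤ k) {x y : Vector Carrier k} →
                      (∀ i → x i ≈ y i) → powerProduct m x ≈ powerProduct m y
  powerProduct-cong m x≈y = sum-cong-≋ λ i → ^-congˡ (m i) (x≈y i)

  AllProducts : Vector ℤ k → Subset → Subset → Set _
  AllProducts {k} m A Y = ∀ (y : Vector Carrier k) → (∀ i → y i ∈ₛ Y) →
                          PairwiseDistinct y → powerProduct m y ∈ₛ A

  -- The right-hand side of the equivalence in (i).
  StronglyRamsey : Vector ℤ k → Subset → Set _
  StronglyRamsey m A = ∀ (X : Subset) → Infinite ⟦ X ⟧ →
    ∃[ Y ] Y ⊆ₛ X × CountablyInfinite ⟦ Y ⟧ × AllProducts m A Y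

  module _ (em : ExcludedMiddle (c ⊔ ℓ)) where

    injectiveSequence : ∀ X → Infinite ⟦ X ⟧ →
                        Σ[ s ∈ (ℕ → Carrier) ] (∀ n → s n ∈ₛ X) × Injective _≡_ _≈_ s
    injectiveSequence X X-inf =
      proj₁ ∘ s , proj₂ ∘ s , distinct-sequence-injective ⟦ X ⟧ em X-inf
      where s = distinct-sequence ⟦ X ⟧ em X-inf

    distinctTuple : ∀ k X → Infinite ⟦ X ⟧ →
                    Σ[ x ∈ Vector Carrier k ] (∀ i → x i ∈ₛ X) × PairwiseDistinct x
    distinctTuple k X X-inf with injectiveSequence X X-inf
    ... | s , s∈X , s-inj =
      s ∘ toℕ , s∈X ∘ toℕ , λ i j i≢j → i≢j ∘ toℕ-injective ∘ s-inj

    -- Any distinct elements of `Y` serve, since rearranging them again gives distinct elements of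
    -- `Y`.
    stronglyRamsey⇒ramsey : (m : Vector ℤ k) (A : Subset) → StronglyRamsey m A → Ramsey m A
    stronglyRamsey⇒ramsey {k} m A strong X X-inf with strong X X-inf
    ... | Y , Y⊆X , Y-countable , Y-products
      with distinctTuple k Y (countablyInfinite⇒infinite Y-countable)
    ... | x , x∈Y , x-distinct = x , Y⊆X ∘ x∈Y , x-distinct , λ σ →
      Y-products (x ∘ (σ ⟨$⟩ʳ_)) (x∈Y ∘ (σ ⟨$⟩ʳ_))
        λ i j i≢j → x-distinct _ _ (i≢j ∘ permute-injective σ)

    module _ (m : Vector ℤ k) (A : Subset) where

      AllPermutations : (ℕ → Carrier) → Vec ℕ k → Set ℓ
      AllPermutations s v = ∀ (σ : Permutation′ k) →
        powerProduct m (λ i → s (Vec.lookup v (σ ⟨$⟩ʳ i))) ∈ₛ A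

      -- Distinct elements of the range carry distinct indices, so the indices can be sorted.
      sortTuple : ∀ (s : ℕ → Carrier) (h : ℕ → ℕ) (y : Vector Carrier k) →
                  (∀ i → y i ∈ₛ range (s ∘ h)) →
                  PairwiseDistinct y →
                  ∃[ v ] Increasing v × Σ[ τ ∈ Permutation′ k ]
                    (∀ i → s (Vec.lookup (Vec.map h v) i) ≈ y (τ ⟨$⟩ʳ i))
      sortTuple s h y y∈ y-distinct with sort (proj₁ ∘ y∈) index-injective
        where
        index-injective : Injective _≡_ _≡_ (proj₁ ∘ y∈)
        index-injective {i} {j} eq = decidable-stable (i Fin.≟ j) λ i≢j → y-distinct i j i≢j
          (trans (proj₂ (y∈ i)) (trans (reflexive (≡.cong (s ∘ h) eq)) (sym (proj₂ (y∈ j)))))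
      ... | v , v-inc , τ , v≗ = v , v-inc , τ , λ i → trans
        (reflexive (≡.cong s (≡.trans (lookup-map i h v) (≡.cong h (v≗ i)))))
        (sym (proj₂ (y∈ (τ ⟨$⟩ʳ i))))

      ramsey⇒stronglyRamsey : Ramsey m A → StronglyRamsey m A
      ramsey⇒stronglyRamsey A-ramsey X X-inf
        with s , s∈X , s-inj ← injectiveSequence X X-inf
        -- `does` turns excluded middle into a two-colouring; `proof` later recovers what each
        -- colour decides.
        with h , h-inc , t , t-hom ← ramsey (lower-em 0ℓ _ em) k
               (λ v → does (lower-em ℓ c em {AllPermutations s v})) =
        Y , (λ (n , x≈shn) → respects X (sym x≈shn) (s∈X (h n))) , Y-countable , Y-products
        where
        Y : Subset
        Y = range (s ∘ h)

        Y-countable : CountablyInfinite ⟦ Y ⟧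
        Y-countable = range-countablyInfinite (strictlyIncreasing⇒injective h-inc ∘ s-inj)

        homogeneous : ∀ v → Increasing v → Reflects (AllPermutations s (Vec.map h v)) t
        homogeneous v v-inc = ≡.subst (Reflects _) (t-hom v v-inc) (proof (lower-em ℓ c em))

        t≡true : t ≡ true
        t≡true with A-ramsey Y (countablyInfinite⇒infinite Y-countable)
        ... | x , x∈Y , x-distinct , x-products with sortTuple s h x x∈Y x-distinct
        -- Permuting the sorted tuple by `σ` permutes `x` by `σ ∘ₚ τ`, so this one increasing tuple
        -- is good and fixes the common colour.
        ... | v , v-inc , τ , v≈ = det (homogeneous v v-inc) (ofʸ λ σ →
          respects A (sym (powerProduct-cong m (v≈ ∘ (σ ⟨$⟩ʳ_)))) (x-products (σ ∘ₚ τ)))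

        Y-products : AllProducts m A Y
        Y-products y y∈Y y-distinct with sortTuple s h y y∈Y y-distinct
        -- The sorted tuple is `y` rearranged by `τ`, so the inverse permutation restores the given
        -- order of `y`.
        ... | v , v-inc , τ , v≈ = respects A
          (powerProduct-cong m λ i →
            trans (v≈ (τ ⟨$⟩ˡ i)) (reflexive (≡.cong y (Perm.inverseʳ τ))))
          (invert (≡.subst (Reflects _) t≡true (homogeneous v v-inc)) (Perm.flip τ))

    -- The filter of Ramsey product subsets.

    ramsey-isFilter : Infinite setoid → (m : Vector ℤ k) → IsFilter (Ramsey m)
    ramsey-isFilter {k} G-inf m = record
      { whole    = λ X X-inf → map₂ (map₂ (_, λ _ → tt)) (distinctTuple k X X-inf)
      ; proper   = λ ∅-ramsey →
          let _ , _ , _ , products = ∅-ramsey Uₛ U-inf in lower (products Perm.id)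
      ; ∩-closed = λ {A} {B} A-ramsey B-ramsey → stronglyRamsey⇒ramsey m (A ∩ₛ B) λ X X-inf →
          let Y , Y⊆X , Y-countable , Y-products = ramsey⇒stronglyRamsey m A A-ramsey X X-inf
              -- The condition for `B` is applied inside `Y`, so the products from `Z` keep lying in
              -- `A`.
              Z , Z⊆Y , Z-countable , Z-products = ramsey⇒stronglyRamsey m B B-ramsey Y
                (countablyInfinite⇒infinite Y-countable)
          in Z , Y⊆X ∘ Z⊆Y , Z-countable , λ z z∈Z z-distinct →
             Y-products z (Z⊆Y ∘ z∈Z) z-distinct , Z-products z z∈Z z-distinct
      ; ⊆-closed = λ A⊆B A-ramsey X X-inf →
          map₂ (map₂ (map₂ (A⊆B ∘_))) (A-ramsey X X-inf)
      }
      where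
      -- Elements of `⟦ Uₛ ⟧` are pairs with a membership proof, so a finite enumeration is carried
      -- to the group by the first projection.
      U-inf : Infinite ⟦ Uₛ ⟧
      U-inf (n , Fin⤖U) = G-inf (n , record
        { to        = proj₁ ∘ to
        ; cong      = cong
        ; bijective = injective , λ y → surjective (y , tt)
        })
        where open Bijection Fin⤖U

theorem5p1 : ∀ {c ℓ : Level} → ExcludedMiddle (c ⊔ ℓ) →
    (G : Group c ℓ) → Infinite (Group.setoid G) →
    (k : ℕ) (m : Vector ℤ k) →
    let open Subsets (Group.setoid G)
        open Products G
    in
    (∀ (A : Subset) →
      Ramsey m A ⇔
      (∀ (X : Subset) → Infinite ⟦ X ⟧ →
        ∃[ Y ] Y ⊆ₛ X × CountablyInfinite ⟦ Y ⟧ ×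
          (∀ (y : Vector (Group.Carrier G) k) → (∀ i → y i ∈ₛ Y) →
            PairwiseDistinct y → powerProduct m y ∈ₛ A)))
    × IsFilter (Ramsey m)
theorem5p1 em G G-infinite k m =
  (λ A → mk⇔ (ramsey⇒stronglyRamsey G em m A) (stronglyRamsey⇒ramsey G em m A)) ,
  ramsey-isFilter G em G-infinite m
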